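{- For every integer $t\geq 2$, $$125 \cdot 7^{t-2} +1 \leq R_t(4).$$
   Context: A tournament of order $m$ is an orientation of the complete graph on $m$ vertices; it is transitive if its vertices can be listed $a_1,\dots,a_m$ with $a_i \to a_j$ for all $i<j$. The multicolor directed Ramsey number $R(n_1,n_2,\dots,n_t)$ is the smallest integer $m$ such that any tournament of order $m$ whose edges have been colored with $t$ colors contains, for some $1 \leq i \leq t$, a transitive subtournament of order $n_i$ all of whose edges have color $i$ (these numbers exist). $R_t(n)$ denotes $R(n,n,\dots,n)$ with $t$ arguments. -}

module Defs where

open import Data.Fin using (Fin; zero; suc)
import Data.Fin.Properties as Fin
open import Data.List using (List; []; _∷_; length; allFin)
open import Data.List.Properties using (length-tabulate)
open import Data.List.Membership.Propositional using (_∈_)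
open import Data.List.Relation.Unary.All as ListAll using ([]; _∷_)
open import Data.List.Relation.Unary.AllPairs using ([]; _∷_)
open import Data.List.Relation.Unary.Any using (here; there)
open import Data.List.Relation.Unary.Unique.Propositional using (Unique)
open import Data.List.Relation.Unary.Unique.Propositional.Properties using (allFin⁺)
open import Data.Maybe using (Maybe; just; nothing; Is-just)
open import Data.Maybe.Properties using (≡-dec)
import Data.Maybe.Relation.Unary.Any as MaybeAny
open import Data.Nat
  using (ℕ; zero; suc; pred; _+_; _≤_; _<_; z≤n; s≤s; _≟_; _≤?_; ≢-nonZero)
open import Data.Nat.Induction using (Acc; acc; <-wellFounded)
open import Data.Nat.Properties
  using ( ≤-refl; ≤-reflexive; ≤-trans; <-≤-trans; ≰⇒>; <⇒≤; m≤n⇒m<n∨m≡n; +-comm; +-monoʳ-<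
        ; +-monoˡ-≤; +-cancelˡ-<; suc-pred; +-suc; +-mono-<; <⇒≱ )
open import Data.Product using (Σ; ∃; _×_; _,_; proj₁; proj₂)
open import Data.Sum using (_⊎_; inj₁; inj₂; [_,_])
open import Data.Unit using (⊤; tt)
open import Data.Vec using (Vec; []; _∷_; _++_; lookup; replicate; sum; tabulate; _[_]%=_)
open import Data.Vec.Properties using (lookup∘tabulate; lookup∘updateAt; lookup∘updateAt′)
open import Data.Vec.Relation.Unary.All as VecAll using ([]; _∷_)
import Data.Vec.Relation.Unary.All.Properties as VecAll
open import Data.Vec.Relation.Unary.AllPairs as VecAllPairs using (AllPairs; []; _∷_)
import Data.Vec.Relation.Unary.AllPairs.Properties as VecAllPairs
open import Function using (_∘_; const; id)
open import Level using (0ℓ)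
open import Relation.Binary using (Rel; Trichotomous; tri<; tri≈; tri>)
open import Relation.Binary.PropositionalEquality
  using (_≡_; _≢_; refl; sym; trans; cong; subst)
open import Relation.Nullary using (Dec; yes; no; contradiction)
open import Relation.Nullary.Decidable using (map′; _×-dec_)
import Relation.Unary as Unary

------------------------------------------------------------------------
-- Directed Ramsey numbers

-- Trichotomy says precisely that there are no loops and that every two
-- distinct vertices are joined in exactly one direction.
record Tournament (m : ℕ) : Set₁ where
  field
    _⟶_     : Rel (Fin m) 0ℓ
    compare : Trichotomous _≡_ _⟶_

-- The proof of u ⟶ v is irrelevant, so that the colour depends on the
-- edge only.
EdgeColouring : {m : ℕ} → Tournament m → ℕ → Set
EdgeColouring T t = ∀ u v → .(u ⟶ v) → Fin t
  where open Tournament T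

ColouredEdge : {m t : ℕ} (T : Tournament m) → EdgeColouring T t → Fin t → Rel (Fin m) 0ℓ
ColouredEdge T χ c u v = Σ (u ⟶ v) λ e → χ u v e ≡ c
  where open Tournament T

-- AllPairs relates each entry to every later entry.  In particular the
-- entries are distinct, since _⟶_ is irreflexive.
MonoTransitive : {m t : ℕ} (T : Tournament m) → EdgeColouring T t → Fin t → ℕ → Set
MonoTransitive {m} T χ c n = ∃ λ (as : Vec (Fin m) n) → AllPairs (ColouredEdge T χ c) as

Forces : {t : ℕ} → Vec ℕ t → ℕ → Set₁
Forces {t} ns m = (T : Tournament m) (χ : EdgeColouring T t) →
                  ∃ λ (i : Fin t) → MonoTransitive T χ i (lookup ns i)

IsRamseyNumber : {t : ℕ} → Vec ℕ t → ℕ → Set₁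
IsRamseyNumber ns m = Forces ns m × (∀ k → Forces ns k → m ≤ k)

------------------------------------------------------------------------
-- Some order forces: pick a vertex, apply the pigeonhole principle to
-- the colour and direction of its edges, and recurse.

private
  Selection : {A : Set} → List A → (A → Set) → ℕ → Set
  Selection {A} xs P n = ∃ λ (ys : List A) →
    ListAll.All (_∈ xs) ys × Unique ys × ListAll.All P ys × n ≤ length ys

  split : {A : Set} {P Q : A → Set} (xs : List A) → Unique xs →
          ListAll.All (λ x → P x ⊎ Q x) xs →
          ∃ λ p → ∃ λ q → p + q ≡ length xs × Selection xs P p × Selection xs Q q
  split [] [] [] =
    0 , 0 , refl , ([] , [] , [] , [] , z≤n) , ([] , [] , [] , [] , z≤n)
  split (x ∷ xs) (x∉ ∷ u) (d ∷ ds) with split xs u ds | d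
  ... | p , q , eq , (ys , y∈ , yu , yP , yl) , (zs , z∈ , zu , zQ , zl) | inj₁ px =
    suc p , q , cong suc eq
    , (x ∷ ys , here refl ∷ ListAll.map there y∈ , ListAll.map (ListAll.lookup x∉) y∈ ∷ yu
      , px ∷ yP , s≤s yl)
    , (zs , ListAll.map there z∈ , zu , zQ , zl)
  ... | p , q , eq , (ys , y∈ , yu , yP , yl) , (zs , z∈ , zu , zQ , zl) | inj₂ qx =
    p , suc q , trans (+-suc p q) (cong suc eq)
    , (ys , ListAll.map there y∈ , yu , yP , yl)
    , (x ∷ zs , here refl ∷ ListAll.map there z∈ , ListAll.map (ListAll.lookup x∉) z∈ ∷ zu
      , qx ∷ zQ , s≤s zl)

  fewer : {A : Set} {P : A → Set} {xs : List A} {m n : ℕ} → m ≤ n →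
          Selection xs P n → Selection xs P m
  fewer m≤n (ys , y∈ , yu , yP , yl) = ys , y∈ , yu , yP , ≤-trans m≤n yl

  pigeonhole : {A : Set} (s : ℕ) (b : Fin s → ℕ) (Q : Fin s → A → Set) (xs : List A) →
               Unique xs → sum (tabulate b) < length xs →
               ListAll.All (λ x → ∃ λ c → Q c x) xs →
               ∃ λ c → Selection xs (Q c) (b c)
  pigeonhole zero b Q (x ∷ xs) u l ((() , _) ∷ _)
  pigeonhole (suc s) b Q xs u l ds
    with split {P = Q zero} {Q = λ x → ∃ λ c → Q (suc c) x} xs u
           (ListAll.map (λ { (zero , q) → inj₁ q ; (suc c , q) → inj₂ (c , q) }) ds)
  ... | p , q , eq , Sp , (zs , z∈ , zu , zQ , zl) with b zero ≤? p
  ...   | yes b≤p = zero , fewer b≤p Sp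
  ...   | no  b≰p
    with pigeonhole s (b ∘ suc) (Q ∘ suc) zs zu
           (<-≤-trans
             (+-cancelˡ-< (b zero) _ _
               (<-≤-trans l (≤-trans (≤-reflexive (sym eq)) (+-monoˡ-≤ q (<⇒≤ (≰⇒> b≰p))))))
             zl)
           zQ
  ...     | c , (ys , y∈ , yu , yQ , yl) =
    suc c , (ys , ListAll.map (ListAll.lookup z∈) y∈ , yu , yQ , yl)

  sum-pred : {t : ℕ} (ns : Vec ℕ t) (i : Fin t) → lookup ns i ≢ 0 →
             sum (ns [ i ]%= pred) < sum ns
  sum-pred (zero  ∷ ns) zero    n≢0 = contradiction refl n≢0
  sum-pred (suc n ∷ ns) zero    n≢0 = ≤-refl
  sum-pred (n ∷ ns)     (suc i) n≢0 = +-monoʳ-< n (sum-pred ns i n≢0)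

  MonoTransitiveIn : {m t : ℕ} (T : Tournament m) → EdgeColouring T t → List (Fin m) →
                     Fin t → ℕ → Set
  MonoTransitiveIn {m} T χ xs c n = ∃ λ (as : Vec (Fin m) n) →
    VecAll.All (_∈ xs) as × AllPairs (ColouredEdge T χ c) as

  ForcesIn : {t : ℕ} → Vec ℕ t → ℕ → Set₁
  ForcesIn {t} ns N = {m : ℕ} (T : Tournament m) (χ : EdgeColouring T t) (xs : List (Fin m)) →
                      Unique xs → N ≤ length xs →
                      ∃ λ i → MonoTransitiveIn T χ xs i (lookup ns i)

  snoc : {m t n : ℕ} (T : Tournament m) (χ : EdgeColouring T t) (c : Fin t)
         (as : Vec (Fin m) n) (v : Fin m) → AllPairs (ColouredEdge T χ c) as →
         VecAll.All (λ a → ColouredEdge T χ c a v) as →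
         AllPairs (ColouredEdge T χ c) (as ++ v ∷ [])
  snoc T χ c as v p q =
    VecAllPairs.++⁺ p ([] ∷ []) (VecAll.map (λ e → e ∷ []) q)

  step : {t : ℕ} (ns : Vec ℕ t) → (∀ i → lookup ns i ≢ 0) →
         (b : Fin t → ℕ) → (∀ i → ForcesIn (ns [ i ]%= pred) (b i)) →
         ForcesIn ns (2 + sum (tabulate (λ i → b i + b i)))
  step {t} ns pos b IH {m} T χ (v ∷ xs) (v∉ ∷ u) (s≤s l) = found
    where
    open Tournament T

    Out In : Fin t → Fin m → Set
    Out c w = ColouredEdge T χ c v w
    In  c w = ColouredEdge T χ c w v

    classify : ∀ {w} → v ≢ w → ∃ λ c → Out c w ⊎ In c w
    classify {w} v≢w with compare v w
    ... | tri< e _ _ = χ v w e , inj₁ (e , refl)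
    ... | tri≈ _ e _ = contradiction e v≢w
    ... | tri> _ _ e = χ w v e , inj₂ (e , refl)

    positive : ∀ i → suc (pred (lookup ns i)) ≡ lookup ns i
    positive i = suc-pred _ ⦃ ≢-nonZero (pos i) ⦄

    -- Recurse in a set ys of vertices, all related to v by D, and try
    -- to extend what is found there by v.
    recurse : (c : Fin t) (D : Fin m → Set) →
              (∀ {n} (as : Vec (Fin m) n) → AllPairs (ColouredEdge T χ c) as →
                VecAll.All D as → VecAll.All (_∈ xs) as →
                MonoTransitiveIn T χ (v ∷ xs) c (suc n)) →
              Selection xs D (b c) →
              ∃ λ i → MonoTransitiveIn T χ (v ∷ xs) i (lookup ns i)
    recurse c D extend (ys , y∈ , yu , yD , yl) with IH c T χ ys yu yl
    ... | j , (as , a∈ , tr) with j Fin.≟ c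
    ...   | no  j≢c = j , subst (MonoTransitiveIn T χ (v ∷ xs) j)
                            (lookup∘updateAt′ j c j≢c ns)
                            (as , VecAll.map (there ∘ ListAll.lookup y∈) a∈ , tr)
    ...   | yes refl = c , subst (MonoTransitiveIn T χ (v ∷ xs) c)
                             (trans (cong suc (lookup∘updateAt c ns)) (positive c))
                             (extend as tr (VecAll.map (ListAll.lookup yD) a∈)
                               (VecAll.map (ListAll.lookup y∈) a∈))

    extendOut : ∀ {c n} (as : Vec (Fin m) n) → AllPairs (ColouredEdge T χ c) as →
                VecAll.All (Out c) as → VecAll.All (_∈ xs) as →
                MonoTransitiveIn T χ (v ∷ xs) c (suc n)
    extendOut as tr ds a∈ = v ∷ as , here refl ∷ VecAll.map there a∈ , ds ∷ tr

    extendIn : ∀ {c n} (as : Vec (Fin m) n) → AllPairs (ColouredEdge T χ c) as →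
               VecAll.All (In c) as → VecAll.All (_∈ xs) as →
               MonoTransitiveIn T χ (v ∷ xs) c (suc n)
    extendIn {c} {n} as tr ds a∈ =
      subst (MonoTransitiveIn T χ (v ∷ xs) c) (+-comm n 1)
        ( as ++ v ∷ []
        , VecAll.++⁺ (VecAll.map there a∈) (here refl ∷ [])
        , snoc T χ c as v tr ds )

    enlarge : ∀ {D n} {ys : List (Fin m)} → ListAll.All (_∈ xs) ys →
              Selection ys D n → Selection xs D n
    enlarge y∈ (zs , z∈ , rest) = zs , ListAll.map (ListAll.lookup y∈) z∈ , rest

    found : ∃ λ i → MonoTransitiveIn T χ (v ∷ xs) i (lookup ns i)
    found with pigeonhole t (λ i → b i + b i) (λ c w → Out c w ⊎ In c w) xs u l
                 (ListAll.map classify v∉)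
    ... | c , (ys , y∈ , yu , yD , yl) with split ys yu yD
    ...   | p , q , eq , Sp , Sq with b c ≤? p | b c ≤? q
    ...     | yes b≤p | _       = recurse c (Out c) extendOut (enlarge y∈ (fewer b≤p Sp))
    ...     | no  _   | yes b≤q = recurse c (In c) extendIn (enlarge y∈ (fewer b≤q Sq))
    ...     | no  b≰p | no  b≰q =
      contradiction yl
        (<⇒≱ (<-≤-trans (≤-reflexive (cong suc (sym eq))) (+-mono-< (≰⇒> b≰p) (≰⇒> b≰q))))

  forcesIn : {t : ℕ} (ns : Vec ℕ t) → Acc _<_ (sum ns) → ∃ (ForcesIn ns)
  forcesIn ns (acc rs) with Fin.any? (λ i → lookup ns i ≟ 0)
  ... | yes (i , eq) = 0 , λ T χ xs _ _ →
          i , subst (MonoTransitiveIn T χ xs i) (sym eq) ([] , [] , [])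
  ... | no  none = _ , step ns pos (proj₁ ∘ IH) (λ i → proj₂ (IH i))
    where
    pos : ∀ i → lookup ns i ≢ 0
    pos i eq = none (i , eq)

    IH : ∀ i → ∃ (ForcesIn (ns [ i ]%= pred))
    IH i = forcesIn (ns [ i ]%= pred) (rs (sum-pred ns i (pos i)))

  someForces : {t : ℕ} (ns : Vec ℕ t) → ∃ (Forces ns)
  someForces ns with forcesIn ns (<-wellFounded (sum ns))
  ... | N , f = N , λ T χ →
    let i , as , _ , tr = f T χ (allFin N) (allFin⁺ N) (≤-reflexive (sym (length-tabulate id)))
    in i , as , tr

------------------------------------------------------------------------
-- Forces is decidable, by enumerating codes of coloured tournaments.

private
  -- The vector gives, for every vertex after the first, the direction
  -- and the colour of the edge joining it to the first.
  Code : ℕ → ℕ → Set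
  Code t zero    = ⊤
  Code t (suc m) = Vec (Fin t ⊎ Fin t) m × Code t m

  outgoing incoming : {A : Set} → A ⊎ A → Maybe A
  outgoing = [ just , const nothing ]
  incoming = [ const nothing , just ]

  arc : {t m : ℕ} → Code t m → Fin m → Fin m → Maybe (Fin t)
  arc {m = suc m} (r , κ) zero    zero    = nothing
  arc {m = suc m} (r , κ) zero    (suc v) = outgoing (lookup r v)
  arc {m = suc m} (r , κ) (suc u) zero    = incoming (lookup r u)
  arc {m = suc m} (r , κ) (suc u) (suc v) = arc κ u v

  compareCode : {t m : ℕ} (κ : Code t m) →
                Trichotomous _≡_ (λ u v → Is-just (arc κ u v))
  compareCode {m = suc m} (r , κ) zero zero = tri≈ (λ ()) refl (λ ())
  compareCode {m = suc m} (r , κ) zero (suc v) with lookup r v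
  ... | inj₁ c = tri< (MaybeAny.just tt) (λ ()) (λ ())
  ... | inj₂ c = tri> (λ ()) (λ ()) (MaybeAny.just tt)
  compareCode {m = suc m} (r , κ) (suc u) zero with lookup r u
  ... | inj₁ c = tri> (λ ()) (λ ()) (MaybeAny.just tt)
  ... | inj₂ c = tri< (MaybeAny.just tt) (λ ()) (λ ())
  compareCode {m = suc m} (r , κ) (suc u) (suc v) with compareCode κ u v
  ... | tri< p q s = tri< p (q ∘ Fin.suc-injective) s
  ... | tri≈ p q s = tri≈ p (cong suc q) s
  ... | tri> p q s = tri> p (q ∘ Fin.suc-injective) s

  decode : {t m : ℕ} → Code t m → Tournament m
  decode κ = record { _⟶_ = λ u v → Is-just (arc κ u v) ; compare = compareCode κ }

  extract : {A : Set} (x : Maybe A) → .(Is-just x) → A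
  extract (just a) _ = a
  extract nothing  ()

  extract-just : {A : Set} {a : A} (x : Maybe A) (p : Is-just x) → extract x p ≡ a → x ≡ just a
  extract-just (just a) p eq = cong just eq

  decodeColour : {t m : ℕ} (κ : Code t m) → EdgeColouring (decode κ) t
  decodeColour κ u v e = extract (arc κ u v) e

  encode : {t : ℕ} (m : ℕ) (P : Fin t → Rel (Fin m) 0ℓ) →
           (∀ u v → u ≢ v → (∃ λ c → P c u v) ⊎ (∃ λ c → P c v u)) →
           ∃ λ (κ : Code t m) → ∀ u v c → arc κ u v ≡ just c → P c u v
  encode         zero    P cls = tt , λ ()
  encode {t = t} (suc m) P cls
    with encode m (λ c u v → P c (suc u) (suc v))
           (λ u v u≢v → cls (suc u) (suc v) (u≢v ∘ Fin.suc-injective))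
  ... | κ , sound = (tabulate row , κ) , sound′
    where
    forget : {A B : Fin t → Set} → ∃ A ⊎ ∃ B → Fin t ⊎ Fin t
    forget (inj₁ (c , _)) = inj₁ c
    forget (inj₂ (c , _)) = inj₂ c

    forward : {A B : Fin t → Set} {c : Fin t} (d : ∃ A ⊎ ∃ B) →
              outgoing (forget d) ≡ just c → A c
    forward (inj₁ (_ , p)) refl = p

    backward : {A B : Fin t → Set} {c : Fin t} (d : ∃ A ⊎ ∃ B) →
               incoming (forget d) ≡ just c → B c
    backward (inj₂ (_ , p)) refl = p

    row : Fin m → Fin t ⊎ Fin t
    row v = forget (cls zero (suc v) (λ ()))

    sound′ : ∀ u v c → arc (tabulate row , κ) u v ≡ just c → P c u v
    sound′ zero (suc v) c eq = forward (cls zero (suc v) (λ ()))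
      (trans (cong outgoing (sym (lookup∘tabulate row v))) eq)
    sound′ (suc u) zero c eq = backward (cls zero (suc u) (λ ()))
      (trans (cong incoming (sym (lookup∘tabulate row u))) eq)
    sound′ (suc u) (suc v) c eq = sound u v c eq

  Exhaustible : Set → Set₁
  Exhaustible A = {P : A → Set} → Unary.Decidable P → Dec (∀ a → P a)

  exhaust-× : {A B : Set} → Exhaustible A → Exhaustible B → Exhaustible (A × B)
  exhaust-× a b P? = map′ (λ f (x , y) → f x y) (λ f x y → f (x , y))
                       (a (λ x → b (λ y → P? (x , y))))

  exhaust-⊎ : {A B : Set} → Exhaustible A → Exhaustible B → Exhaustible (A ⊎ B)
  exhaust-⊎ a b P? = map′ (λ { (f , g) (inj₁ x) → f x ; (f , g) (inj₂ y) → g y })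
                       (λ f → f ∘ inj₁ , f ∘ inj₂)
                       (a (P? ∘ inj₁) ×-dec b (P? ∘ inj₂))

  exhaust-Vec : {A : Set} (n : ℕ) → Exhaustible A → Exhaustible (Vec A n)
  exhaust-Vec zero    a P? = map′ (λ { p [] → p }) (λ f → f []) (P? [])
  exhaust-Vec (suc n) a P? = map′ (λ { f (x ∷ xs) → f x xs }) (λ f x xs → f (x ∷ xs))
                               (a (λ x → exhaust-Vec n a (λ xs → P? (x ∷ xs))))

  exhaust-Code : (t m : ℕ) → Exhaustible (Code t m)
  exhaust-Code t zero    P? = map′ (λ p _ → p) (λ f → f tt) (P? tt)
  exhaust-Code t (suc m) =
    exhaust-× (exhaust-Vec m (exhaust-⊎ Fin.all? Fin.all?)) (exhaust-Code t m)

  anyVec? : {m : ℕ} (n : ℕ) {P : Vec (Fin m) n → Set} → Unary.Decidable P → Dec (∃ P)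
  anyVec? zero    P? = map′ (λ p → [] , p) (λ { ([] , p) → p }) (P? [])
  anyVec? (suc n) P? = map′ (λ (x , xs , p) → x ∷ xs , p) (λ { (x ∷ xs , p) → x , xs , p })
                         (Fin.any? (λ x → anyVec? n (λ xs → P? (x ∷ xs))))

  CodeHas : {t m : ℕ} → Vec ℕ t → Code t m → Set
  CodeHas {t} {m} ns κ = ∃ λ (i : Fin t) → ∃ λ (as : Vec (Fin m) (lookup ns i)) →
                         AllPairs (λ u v → arc κ u v ≡ just i) as

  codeHas? : {t m : ℕ} (ns : Vec ℕ t) → Unary.Decidable (CodeHas {t} {m} ns)
  codeHas? ns κ = Fin.any? λ i → anyVec? (lookup ns i)
    (VecAllPairs.allPairs? (λ u v → ≡-dec Fin._≟_ (arc κ u v) (just i)))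

  forces? : {t : ℕ} (ns : Vec ℕ t) → Unary.Decidable (Forces ns)
  forces? {t} ns m = map′ to from (exhaust-Code t m (codeHas? ns))
    where
    to : (∀ κ → CodeHas ns κ) → Forces ns m
    to has T χ = i , as , VecAllPairs.map (λ {u} {v} → sound u v i) tr
      where
      open Tournament T

      classify : ∀ u v → u ≢ v →
                 (∃ λ c → ColouredEdge T χ c u v) ⊎ (∃ λ c → ColouredEdge T χ c v u)
      classify u v u≢v with compare u v
      ... | tri< e _ _ = inj₁ (χ u v e , e , refl)
      ... | tri≈ _ e _ = contradiction e u≢v
      ... | tri> _ _ e = inj₂ (χ v u e , e , refl)

      encoded = encode m (ColouredEdge T χ) classify
      κ     = proj₁ encoded
      sound = proj₂ encoded
      i     = proj₁ (has κ)
      as    = proj₁ (proj₂ (has κ))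
      tr    = proj₂ (proj₂ (has κ))

    from : Forces ns m → ∀ κ → CodeHas ns κ
    from f κ with f (decode κ) (decodeColour κ)
    ... | i , as , tr =
      i , as , VecAllPairs.map (λ {u} {v} (e , eq) → extract-just (arc κ u v) e eq) tr

  least : {P : ℕ → Set₁} → Unary.Decidable P → ∃ P → ∃ λ m → P m × (∀ k → P k → m ≤ k)
  least {P} P? (N , pN) with search N
    where
    search : ∀ n → (∃ λ m → P m × (∀ k → P k → m ≤ k)) ⊎ (∀ k → P k → n ≤ k)
    search zero = inj₂ (λ _ _ → z≤n)
    search (suc n) with search n
    ... | inj₁ found = inj₁ found
    ... | inj₂ below with P? n
    ...   | yes pn = inj₁ (n , pn , below)
    ...   | no ¬pn = inj₂ λ k pk → [ id , (λ { refl → contradiction pk ¬pn }) ]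
                                     (m≤n⇒m<n∨m≡n (below k pk))
  ... | inj₁ found = found
  ... | inj₂ below = N , pN , below

-- Opaque only to keep type checking from running the search.
opaque
  ramseyNumber : {t : ℕ} (ns : Vec ℕ t) → ∃ (IsRamseyNumber ns)
  ramseyNumber ns = least (forces? ns) (someForces ns)

R : {t : ℕ} → Vec ℕ t → ℕ
R ns = proj₁ (ramseyNumber ns)

R-isRamseyNumber : {t : ℕ} (ns : Vec ℕ t) → IsRamseyNumber ns (R ns)
R-isRamseyNumber ns = proj₂ (ramseyNumber ns)

R[_]_ : (t n : ℕ) → ℕ
R[ t ] n = R (replicate t n)

{-# OPTIONS --safe #-}
module Submission where

-- It suffices to colour the edges of a tournament on 125 * 7 ^ (t - 2)
-- vertices with t colours so that no transitive subtournament of order 4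
-- is monochromatic: such a colouring restricts to every smaller vertex
-- set (Avoidable-≤), so the Ramsey number must exceed its order
-- (Avoidable⇒<).
--
-- For t = 2 the vertices are the elements of GF(125) = F₅[θ] with
-- θ³ + θ + 1 = 0.  Let N be the norm down to F₅, N(x) = x³¹.  Since 3 is
-- odd, N(-x) = -N(x), so that u → v when N(v - u) is 1 or 2 defines a
-- tournament; colour the edge u → v with N(v - u).  The two colour classes
-- are translation-invariant, and a finite search for transitive
-- quadruples starting at 0 finds none (norm-avoids).
--
-- For one more colour, replace every vertex of the Paley tournament of
-- order 7, which contains no transitive subtournament of order 4
-- (paley-avoids), by a copy of the tournament already built, and give the
-- new colour to the edges between copies.  A monochromatic transitive set
-- in this lexicographic product lies in a single copy or has its vertices
-- in distinct copies (Avoidable-*), so the order is multiplied by 7.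

open import Defs
open import Algebra.Properties.CommutativeSemigroup using (x∙yz≈y∙xz)
open import Data.Empty using (⊥-elim-irr)
open import Data.Bool using (true; false; not)
import Data.Bool.Properties as Bool
open import Data.Fin using (Fin; zero; suc; toℕ; _↑ˡ_; _↑ʳ_; splitAt; remQuot; combine; inject≤)
import Data.Fin.Properties as Fin
open import Data.Maybe using (Maybe; just; nothing; is-just)
open import Data.Maybe.Properties using (≡-dec)
open import Data.Nat
  using (ℕ; zero; suc; _+_; _*_; _∸_; _^_; _≤_; _<_; _%_; s≤s)
open import Data.Nat.DivMod using (_mod_)
open import Data.Nat.Properties using (+-comm; ≰⇒>; *-commutativeSemigroup)
open import Data.Product using (∃; _×_; _,_; proj₁; proj₂; uncurry)
open import Data.Sum using (_⊎_; inj₁; inj₂)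
open import Data.Vec using (Vec; []; _∷_; _++_; lookup; replicate; zipWith)
open import Data.Vec.Properties
  using (∷-injective; lookup-replicate; lookup-splitAt) renaming (≡-dec to Vec-≡-dec)
open import Data.Vec.Relation.Unary.AllPairs as AllPairs using (AllPairs; []; _∷_)
import Data.Vec.Relation.Unary.AllPairs.Properties as AllPairs
open import Data.Vec.Relation.Unary.All using ([]; _∷_)
open import Data.Product.Relation.Binary.Lex.Strict using (×-Lex; ×-compare)
open import Data.Product.Relation.Binary.Pointwise.NonDependent using (≡×≡⇒≡; ≡⇒≡×≡)
open import Function using (_∘_; _on_)
open import Function.Definitions using (Injective)
open import Level using (0ℓ)
open import Relation.Binary using (Rel; Trichotomous; Tri; tri<; tri≈; tri>; DecidableEquality)
open import Relation.Binary.PropositionalEquality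
  using (_≡_; _≢_; refl; sym; trans; cong; cong₂; subst)
open import Relation.Nullary using (¬_; Dec; yes; no; contradiction)
open import Relation.Nullary.Decidable
  using (True; toWitness; map′; _×-dec_; _→-dec_; ¬?)
import Relation.Unary as Unary

------------------------------------------------------------------------
-- Coloured tournaments on an arbitrary vertex type

-- Edge c is the set of edges of colour c.  Nothing forbids an edge with several
-- colours: this only makes it harder to avoid monochromatic sets.
record ColouredTournament (V : Set) (t : ℕ) : Set₁ where
  field
    Edge    : Fin t → Rel V 0ℓ
    compare : Trichotomous _≡_ (λ u v → ∃ λ c → Edge c u v)

open ColouredTournament

-- For no colour i is there a transitive subtournament of order
-- lookup ns i with all its edges of colour i.
Avoids : {V : Set} {t : ℕ} → ColouredTournament V t → Vec ℕ t → Set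
Avoids {V} T ns = ∀ i (as : Vec V (lookup ns i)) → ¬ AllPairs (Edge T i) as

-- Some coloured tournament of order m avoids ns.
record Avoidable {t : ℕ} (ns : Vec ℕ t) (m : ℕ) : Set₁ where
  constructor _,_
  field
    tournament : ColouredTournament (Fin m) t
    avoids     : Avoids tournament ns

Tri-map : {A B C A′ B′ C′ : Set} → (A → A′) → (A′ → A) → (B → B′) → (B′ → B) →
          (C → C′) → (C′ → C) → Tri A B C → Tri A′ B′ C′
Tri-map f f⁻ g g⁻ h h⁻ (tri< a ¬b ¬c) = tri< (f a) (¬b ∘ g⁻) (¬c ∘ h⁻)
Tri-map f f⁻ g g⁻ h h⁻ (tri≈ ¬a b ¬c) = tri≈ (¬a ∘ f⁻) (g b) (¬c ∘ h⁻)
Tri-map f f⁻ g g⁻ h h⁻ (tri> ¬a ¬b c) = tri> (¬a ∘ f⁻) (¬b ∘ g⁻) (h c)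

-- The subtournament induced on the image of an injection.
induced : {U V : Set} {t : ℕ} (f : U → V) → Injective _≡_ _≡_ f →
          ColouredTournament V t → ColouredTournament U t
induced f inj T = record
  { Edge    = λ c → Edge T c on f
  ; compare = λ u v → Tri-map (λ e → e) (λ e → e) inj (cong f) (λ e → e) (λ e → e)
                        (compare T (f u) (f v))
  }

induced-avoids : {U V : Set} {t : ℕ} (f : U → V) (inj : Injective _≡_ _≡_ f)
                 (T : ColouredTournament V t) (ns : Vec ℕ t) →
                 Avoids T ns → Avoids (induced f inj T) ns
induced-avoids f inj T ns av i as p = av i _ (AllPairs.map⁺ {f = f} p)

Avoidable-≤ : {t : ℕ} {ns : Vec ℕ t} {m n : ℕ} → m ≤ n → Avoidable ns n → Avoidable ns m
Avoidable-≤ {ns = ns} m≤n (T , av) = induced f inj T , induced-avoids f inj T ns av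
  where
  f = λ i → inject≤ i m≤n

  inj : Injective _≡_ _≡_ f
  inj = Fin.inject≤-injective m≤n m≤n _ _

Avoidable⇒¬Forces : {t : ℕ} {ns : Vec ℕ t} {m : ℕ} → Avoidable ns m → ¬ Forces ns m
Avoidable⇒¬Forces {t} {ns} {m} (T , av) forces =
  let i , as , p = forces tournament colour in av i as (AllPairs.map edge p)
  where
  tournament : Tournament m
  tournament = record { compare = compare T }

  -- The colour is read off from the comparison of u and v, which does not
  -- depend on the given proof of u ⟶ v.
  colour : EdgeColouring tournament t
  colour u v e with compare T u v
  ... | tri< (c , _) _ _ = c
  ... | tri≈ ¬e _ _ = ⊥-elim-irr (¬e e)
  ... | tri> ¬e _ _ = ⊥-elim-irr (¬e e)

  edge : ∀ {i u v} → ColouredEdge tournament colour i u v → Edge T i u v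
  edge {i} {u} {v} (e , eq) with compare T u v
  ... | tri< (c , d) _ _ = subst (λ c → Edge T c u v) eq d
  ... | tri≈ ¬e _ _ = contradiction e ¬e
  ... | tri> ¬e _ _ = contradiction e ¬e

Avoidable⇒< : {t : ℕ} {ns : Vec ℕ t} {m r : ℕ} → Avoidable ns m → IsRamseyNumber ns r → m < r
Avoidable⇒< av (forces , _) =
  ≰⇒> λ r≤m → Avoidable⇒¬Forces (Avoidable-≤ r≤m av) forces

------------------------------------------------------------------------
-- Lexicographic products

module _ {V W : Set} {s t : ℕ} (S : ColouredTournament V s) (T : ColouredTournament W t) where

  -- In the lexicographic product every vertex of S is replaced by a copy of
  -- T.  Edges between two copies are coloured as in S, with the first s
  -- colours; those inside a copy as in T, with the last t colours.
  LexEdge : Fin s ⊎ Fin t → Rel (V × W) 0ℓ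
  LexEdge (inj₁ c) (v , w) (v′ , w′) = Edge S c v v′
  LexEdge (inj₂ c) (v , w) (v′ , w′) = v ≡ v′ × Edge T c w w′

  lex : ColouredTournament (V × W) (s + t)
  lex = record
    { Edge    = λ c → LexEdge (splitAt s c)
    ; compare = λ x y → Tri-map (to x y) (from x y) ≡×≡⇒≡ ≡⇒≡×≡ (to y x) (from y x)
                          (×-compare sym (compare S) (compare T) x y)
    }
    where
    _⟶_ = ×-Lex _≡_ (λ u v → ∃ λ c → Edge S c u v) (λ u v → ∃ λ c → Edge T c u v)

    to : ∀ x y → x ⟶ y → ∃ λ c → LexEdge (splitAt s c) x y
    to x y (inj₁ (c , e)) =
      c ↑ˡ t , subst (λ k → LexEdge k x y) (sym (Fin.splitAt-↑ˡ s c t)) e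
    to x y (inj₂ (eq , c , e)) =
      s ↑ʳ c , subst (λ k → LexEdge k x y) (sym (Fin.splitAt-↑ʳ s t c)) (eq , e)

    from : ∀ x y → ∃ (λ c → LexEdge (splitAt s c) x y) → x ⟶ y
    from x y (c , e) with splitAt s c
    ... | inj₁ c′ = inj₁ (c′ , e)
    ... | inj₂ c′ = inj₂ (proj₁ e , c′ , proj₂ e)

  lex-avoids : {ms : Vec ℕ s} {ns : Vec ℕ t} →
               Avoids S ms → Avoids T ns → Avoids lex (ms ++ ns)
  lex-avoids {ms} {ns} avS avT c rewrite lookup-splitAt s ms ns c with splitAt s c
  ... | inj₁ i = λ as p → avS i _ (AllPairs.map⁺ {f = proj₁} p)
  ... | inj₂ i = λ as p → avT i _ (AllPairs.map⁺ {f = proj₂} (AllPairs.map proj₂ p))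

remQuot-injective : ∀ m n → Injective _≡_ _≡_ (remQuot {m} n)
remQuot-injective m n {i} {j} eq =
  trans (sym (Fin.combine-remQuot {m} n i))
        (trans (cong (uncurry combine) eq) (Fin.combine-remQuot {m} n j))

Avoidable-* : {s t m n : ℕ} {ms : Vec ℕ s} {ns : Vec ℕ t} →
              Avoidable ms m → Avoidable ns n → Avoidable (ms ++ ns) (m * n)
Avoidable-* {m = m} {n} {ms} {ns} (S , avS) (T , avT) =
  induced (remQuot n) (remQuot-injective m n) (lex S T) ,
  induced-avoids (remQuot n) (remQuot-injective m n) (lex S T) (ms ++ ns)
    (lex-avoids S T {ms} {ns} avS avT)

------------------------------------------------------------------------
-- Differences

-- A group presented by its subtraction x - y, the sum of x and the inverse
-- of y; the three laws hold in every group.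
record Difference (G : Set) : Set where
  infixl 6 _-_
  field
    0#      : G
    _-_     : G → G → G
    x-x≡0   : ∀ x → x - x ≡ 0#
    x-y≡0⇒≡ : ∀ x y → x - y ≡ 0# → x ≡ y
    cancel  : ∀ x y z → (z - x) - (y - x) ≡ z - y

  0-[x-y]≡y-x : ∀ x y → 0# - (x - y) ≡ y - x
  0-[x-y]≡y-x x y = trans (cong (_- (x - y)) (sym (x-x≡0 y))) (cancel y x y)

-- Subtraction modulo suc n.  Its laws are left to a finite check.
module _ (n : ℕ) where

  private
    _-ₘ_ : Fin (suc n) → Fin (suc n) → Fin (suc n)
    i -ₘ j = (toℕ i + (suc n ∸ toℕ j)) mod suc n

    Laws : Set
    Laws = (∀ i → i -ₘ i ≡ zero) × (∀ i j → i -ₘ j ≡ zero → i ≡ j) ×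
           (∀ i j k → (k -ₘ i) -ₘ (j -ₘ i) ≡ k -ₘ j)

    laws? : Dec Laws
    laws? = (Fin.all? λ i → i -ₘ i Fin.≟ zero) ×-dec
            (Fin.all? λ i → Fin.all? λ j → (i -ₘ j Fin.≟ zero) →-dec (i Fin.≟ j)) ×-dec
            (Fin.all? λ i → Fin.all? λ j → Fin.all? λ k →
              (k -ₘ i) -ₘ (j -ₘ i) Fin.≟ k -ₘ j)

  ℤ/ : {True laws?} → Difference (Fin (suc n))
  ℤ/ {ok} = record
    { 0# = zero ; _-_ = _-ₘ_
    ; x-x≡0 = proj₁ laws ; x-y≡0⇒≡ = proj₁ (proj₂ laws) ; cancel = proj₂ (proj₂ laws)
    }
    where laws = toWitness ok

-- The direct power.
power : {G : Set} → Difference G → (k : ℕ) → Difference (Vec G k)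
power {G} D k = record
  { 0# = replicate k 0# ; _-_ = zipWith _-_
  ; x-x≡0 = x-x ; x-y≡0⇒≡ = separated ; cancel = cancels
  }
  where
  open Difference D

  x-x : ∀ {k} (x : Vec G k) → zipWith _-_ x x ≡ replicate k 0#
  x-x []      = refl
  x-x (a ∷ x) = cong₂ _∷_ (x-x≡0 a) (x-x x)

  separated : ∀ {k} (x y : Vec G k) → zipWith _-_ x y ≡ replicate k 0# → x ≡ y
  separated []      []      _  = refl
  separated (a ∷ x) (b ∷ y) eq =
    cong₂ _∷_ (x-y≡0⇒≡ a b (proj₁ (∷-injective eq))) (separated x y (proj₂ (∷-injective eq)))

  cancels : ∀ {k} (x y z : Vec G k) →
            zipWith _-_ (zipWith _-_ z x) (zipWith _-_ y x) ≡ zipWith _-_ z y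
  cancels []      []      []      = refl
  cancels (a ∷ x) (b ∷ y) (c ∷ z) = cong₂ _∷_ (cancel a b c) (cancels x y z)

------------------------------------------------------------------------
-- Cayley tournaments

module Cayley {G : Set} (D : Difference G) (_≟_ : DecidableEquality G)
              {t : ℕ} (class : G → Maybe (Fin t)) where

  open Difference D

  -- Exactly one element of each pair x, -x with x nonzero has a class, and
  -- 0 has none.
  Antisymmetric : Set
  Antisymmetric = class 0# ≡ nothing ×
                  (∀ x → x ≢ 0# → is-just (class (0# - x)) ≡ not (is-just (class x)))

  -- The edges of colour c of the Cayley tournament.
  E : Fin t → Rel G 0ℓ
  E c u v = class (v - u) ≡ just c

  private
    HasClass : G → Set
    HasClass x = ∃ λ c → class x ≡ just c

    hasClass : ∀ x → is-just (class x) ≡ true → HasClass x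
    hasClass x eq with class x
    ... | just c = c , refl

    noClass : ∀ x → is-just (class x) ≡ false → ¬ HasClass x
    noClass x eq (c , eq′) with class x
    noClass x () (c , refl) | just c

  tournament : Antisymmetric → ColouredTournament G t
  tournament (class-0 , class-neg) = record { Edge = E ; compare = cmp }
    where
    loopless : ∀ u → ¬ HasClass (u - u)
    loopless u rewrite x-x≡0 u | class-0 = λ ()

    cmp : Trichotomous _≡_ (λ u v → HasClass (v - u))
    cmp u v with u ≟ v
    ... | yes refl = tri≈ (loopless u) refl (loopless u)
    ... | no u≢v with class-neg (v - u) (u≢v ∘ sym ∘ x-y≡0⇒≡ v u)
    ...   | neg rewrite 0-[x-y]≡y-x v u with is-just (class (v - u)) in eq
    ...     | true  = tri< (hasClass _ eq) u≢v (noClass _ neg)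
    ...     | false = tri> (noClass _ eq) u≢v (hasClass _ neg)

  -- By translation invariance it suffices to consider the transitive
  -- quadruples 0, x, y, z.  The hypotheses are interleaved with the
  -- quantifiers to prune the search.
  NoQuadrupleAt0 : Set
  NoQuadrupleAt0 = ∀ c x → class x ≡ just c → ∀ y → class y ≡ just c → E c x y →
                   ∀ z → class z ≡ just c → E c x z → ¬ E c y z

  avoids : (anti : Antisymmetric) → NoQuadrupleAt0 → Avoids (tournament anti) (replicate t 4)
  avoids anti none c rewrite lookup-replicate c 4 = no4
    where
    shift : ∀ o {x y} → E c x y → E c (x - o) (y - o)
    shift o {x} {y} e = trans (cong class (cancel o x y)) e

    no4 : (as : Vec G 4) → ¬ AllPairs (E c) as
    no4 (o ∷ x ∷ y ∷ z ∷ []) ((ox ∷ oy ∷ oz ∷ []) ∷ (xy ∷ xz ∷ []) ∷ (yz ∷ []) ∷ _) =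
      none c (x - o) ox (y - o) oy (shift o xy) (z - o) oz (shift o xz) (shift o yz)

  module _ (all? : {P : G → Set} → Unary.Decidable P → Dec (∀ x → P x)) where

    antisymmetric? : Dec Antisymmetric
    antisymmetric? =
      ≡-dec Fin._≟_ (class 0#) nothing ×-dec
      all? (λ x → ¬? (x ≟ 0#) →-dec (is-just (class (0# - x)) Bool.≟ not (is-just (class x))))

    noQuadrupleAt0? : Dec NoQuadrupleAt0
    noQuadrupleAt0? = Fin.all? λ c → all? λ x → is c x →-dec
      all? λ y → is c y →-dec (is c (y - x) →-dec
      all? λ z → is c z →-dec (is c (z - x) →-dec ¬? (is c (z - y))))
      where
      is : ∀ c x → Dec (class x ≡ just c)
      is c x = ≡-dec Fin._≟_ (class x) (just c)

------------------------------------------------------------------------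
-- The norm tournament of order 125 and the Paley tournament of order 7

allVec? : {m k : ℕ} {P : Vec (Fin m) k → Set} → Unary.Decidable P → Dec (∀ xs → P xs)
allVec? {k = zero}  P? = map′ (λ { p [] → p }) (λ f → f []) (P? [])
allVec? {k = suc k} P? = map′ (λ { f (x ∷ xs) → f x xs }) (λ f x xs → f (x ∷ xs))
                           (Fin.all? λ x → allVec? λ xs → P? (x ∷ xs))

-- The digits of a number below m ^ k in base m.
digits : ∀ m k → Fin (m ^ k) → Vec (Fin m) k
digits m zero    _ = []
digits m (suc k) i = proj₁ (remQuot {m} (m ^ k) i) ∷ digits m k (proj₂ (remQuot {m} (m ^ k) i))

digits-injective : ∀ m k → Injective _≡_ _≡_ (digits m k)
digits-injective m zero    {zero} {zero} _ = refl
digits-injective m (suc k) eq =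
  remQuot-injective m (m ^ k)
    (cong₂ _,_ (proj₁ (∷-injective eq)) (digits-injective m k (proj₂ (∷-injective eq))))

-- The norm tournament has u → v, of colour 0 or 1, when v - u has norm 1
-- or 2.  The coordinate vector (a , b , c) stands for a + bθ + cθ².  Its
-- norm is the determinant of the multiplication by this element,
-- a³ - b³ + c³ - 2a²c + ac² + ab² + 3abc - bc², here with coefficients
-- reduced modulo 5 to natural numbers.
normClass : Vec (Fin 5) 3 → Maybe (Fin 2)
normClass (x ∷ y ∷ z ∷ []) = class (norm (toℕ x) (toℕ y) (toℕ z) % 5)
  where
  norm : ℕ → ℕ → ℕ → ℕ
  norm a b c = a * a * a + 4 * (b * b * b) + c * c * c + 3 * (a * a * c) + a * c * c
             + a * b * b + 3 * (a * b * c) + 4 * (b * c * c)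

  class : ℕ → Maybe (Fin 2)
  class 1 = just zero
  class 2 = just (suc zero)
  class _ = nothing

module Norm = Cayley (power (ℤ/ 4) 3) (Vec-≡-dec Fin._≟_) normClass

norm-avoids : Avoidable (replicate 2 4) 125
norm-avoids =
  induced (digits 5 3) (digits-injective 5 3) (Norm.tournament anti) ,
  induced-avoids (digits 5 3) (digits-injective 5 3) (Norm.tournament anti) (replicate 2 4)
    (Norm.avoids anti (toWitness {a? = Norm.noQuadrupleAt0? allVec?} _))
  where
  anti : Norm.Antisymmetric
  anti = toWitness {a? = Norm.antisymmetric? allVec?} _

-- The Paley tournament of order 7 has i → j when j - i is a nonzero square
-- modulo 7, that is, when its cube is 1.
paleyClass : Fin 7 → Maybe (Fin 1)
paleyClass x = class (toℕ x ^ 3 % 7)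
  where
  class : ℕ → Maybe (Fin 1)
  class 1 = just zero
  class _ = nothing

module Paley = Cayley (ℤ/ 6) Fin._≟_ paleyClass

paley-avoids : Avoidable (replicate 1 4) 7
paley-avoids = Paley.tournament anti ,
               Paley.avoids anti (toWitness {a? = Paley.noQuadrupleAt0? Fin.all?} _)
  where
  anti : Paley.Antisymmetric
  anti = toWitness {a? = Paley.antisymmetric? Fin.all?} _

------------------------------------------------------------------------
-- The lower bound

Avoidable-125*7^k : ∀ k → Avoidable (replicate (2 + k) 4) (125 * 7 ^ k)
Avoidable-125*7^k zero    = norm-avoids
Avoidable-125*7^k (suc k) =
  subst (Avoidable _) 7*[125*7^k]≡125*7^[1+k] (Avoidable-* paley-avoids (Avoidable-125*7^k k))
  where
  7*[125*7^k]≡125*7^[1+k] : 7 * (125 * 7 ^ k) ≡ 125 * 7 ^ suc k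
  7*[125*7^k]≡125*7^[1+k] = x∙yz≈y∙xz *-commutativeSemigroup 7 125 (7 ^ k)

corollary2p5 : (t : ℕ) → 2 ≤ t → 125 * 7 ^ (t ∸ 2) + 1 ≤ R[ t ] 4
corollary2p5 (suc zero) (s≤s ())
corollary2p5 (suc (suc k)) _ =
  subst (_≤ R[ 2 + k ] 4) (+-comm 1 (125 * 7 ^ k))
    (Avoidable⇒< (Avoidable-125*7^k k) (R-isRamseyNumber _))
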